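{- There is an $O(\log^2 n)$-competitive randomized Monte Carlo algorithm for the network discovery problem in the Layered Graph Query Model. That is, there exist an absolute constant $C>0$ and a randomized online algorithm such that, for every $n\ge 2$ and every connected, undirected, unweighted graph $G=(V,E)$ on $n$ vertices, with high probability the algorithm discovers $G$ (that is, the vertices it queries certify all edges and all non-edges of $G$) using at most $C\cdot\log^2 n\cdot OPT(G)$ queries, where $OPT(G)$ is the minimum number of queries that suffice to certify all edges and non-edges of $G$.
   Context: Let $G=(V,E)$ be a connected, undirected, unweighted simple graph with $n$ vertices and let $d(x,y)$ denote the shortest-path distance in $G$. Pairs of distinct vertices $\{x,y\}$ in $E$ are called edges, and those not in $E$ are called non-edges; $\overline{E}$ denotes the set of non-edges. Layered Graph Query Model: a query at a vertex $v\in V$ returns the set of all edges of $G$ that lie on shortest paths from $v$ to any other vertex. Equivalently, a query at $v$ reveals all edges and all non-edges between vertices at different distances from $v$. The query at $v$ certifies the pair $\{x,y\}$ (confirms its presence in or absence from $E$) if and only if $d(v,x)\ne d(v,y)$. Let $Q_v$ be the set of pairs of distinct vertices certified by the query at $v$. A set $V'\subseteq V$ of queried vertices certifies all edges and non-edges of $G$ if $\bigcup_{v\in V'}Q_v=E\cup\overline{E}$. $OPT(G)$ is the minimum of $|V'|$ over all $V'\subseteq V$ with $\bigcup_{v\in V'}Q_v=E\cup\overline{E}$ (the offline optimum, where $G$ is known in advance). Network discovery problem (online): the vertex set $V$ is known to the algorithm but $E$ is not; the algorithm chooses vertices to query one after another, possibly adaptively and using random bits, where each choice may depend only on $V$, the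 answers to earlier queries and the random bits, and must discover all edges and non-edges of $G$. The cost is the number of queries made. "With high probability" means with probability at least $1-1/n$ over the random choices of the algorithm; Monte Carlo means that the algorithm may fail with the remaining probability. -}

module Defs where

open import Data.Bool.Base using (Bool; true; false; if_then_else_)
open import Data.Fin.Base using (Fin)
open import Data.Fin.Properties using (_≟_; any?; all?)
open import Data.Fin.Subset using (Subset; ⊤; ∣_∣) renaming (_∈_ to _∈ₛ_)
open import Data.Fin.Subset.Properties using (anySubset?; ∈⊤) renaming (_∈?_ to _∈ₛ?_)
open import Data.Integer.Base using (+_)
open import Data.List.Base using (List; []; _∷_)
open import Data.Nat.Base using (ℕ; zero; suc; _+_; _≤_; _<_; z≤n; s≤s; NonTrivial; nonTrivial⇒nonZero)
import Data.Nat.Properties as ℕ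
open import Data.Product.Base using (∃; _×_; _,_; proj₁; proj₂)
open import Data.Rational.Base as ℚ using (ℚ; 0ℚ; 1ℚ; ½; _/_)
open import Data.Sum.Base using (_⊎_; inj₁; inj₂)
open import Level using (Level; 0ℓ)
open import Relation.Binary.Core using (Rel)
import Relation.Binary.Definitions as Binary
open import Relation.Binary.PropositionalEquality
  using (_≡_; _≢_; refl; sym; trans; cong; subst; ≢-sym)
open import Relation.Nullary.Decidable
  using (Dec; yes; no; does; map′; ¬?; _×-dec_; _→-dec_)
open import Relation.Nullary.Negation using (contradiction)
open import Relation.Unary using (Pred; Decidable)

private variable
  n : ℕ
  ℓ : Level

least : {P : Pred ℕ ℓ} → Decidable P → ∀ k → P k → ∃ λ m → P m × (∀ j → P j → m ≤ j)
least P? zero    p = 0 , p , λ _ _ → z≤n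
least P? (suc k) p with P? 0
... | yes p₀ = 0 , p₀ , λ _ _ → z≤n
... | no ¬p₀ with least (λ i → P? (suc i)) k p
...   | m , pm , min = suc m , pm , λ where
  zero    p₀ → contradiction p₀ ¬p₀
  (suc j) pj → s≤s (min j pj)

infixr 5 _∷_

data Walk {n : ℕ} (_~_ : Rel (Fin n) 0ℓ) : ℕ → Rel (Fin n) 0ℓ where
  []  : ∀ {x} → Walk _~_ 0 x x
  _∷_ : ∀ {k x y z} → x ~ y → Walk _~_ k y z → Walk _~_ (suc k) x z

record ConnectedGraph (n : ℕ) : Set₁ where
  infix 4 _~_ _~?_
  field
    _~_       : Rel (Fin n) 0ℓ
    _~?_      : Binary.Decidable _~_
    ~-sym     : Binary.Symmetric _~_
    ~-irrefl  : Binary.Irreflexive _≡_ _~_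
    connected : ∀ x y → ∃ λ k → Walk _~_ k x y

module Distance {n : ℕ} (G : ConnectedGraph n) where
  open ConnectedGraph G

  walk? : ∀ k x y → Dec (Walk _~_ k x y)
  walk? zero    x y = map′ (λ { refl → [] }) (λ { [] → refl }) (x ≟ y)
  walk? (suc k) x z =
    map′ (λ { (_ , e , w) → e ∷ w }) (λ { (e ∷ w) → _ , e , w })
         (any? λ y → (x ~? y) ×-dec walk? k y z)

  shortest : ∀ x y → ∃ λ k → Walk _~_ k x y × (∀ j → Walk _~_ j x y → k ≤ j)
  shortest x y = least (λ k → walk? k x y) _ (proj₂ (connected x y))

  d : Fin n → Fin n → ℕ
  d x y = proj₁ (shortest x y)

  d-walk : ∀ x y → Walk _~_ (d x y) x y
  d-walk x y = proj₁ (proj₂ (shortest x y))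

  d-min : ∀ {k} x y → Walk _~_ k x y → d x y ≤ k
  d-min x y = proj₂ (proj₂ (shortest x y)) _

  -- Some shortest path from v to w runs through the edge {x,y}, from x to y.
  ShortestPathThrough : (v w x y : Fin n) → Set
  ShortestPathThrough v w x y =
    ∃ λ i → ∃ λ j → Walk _~_ i v x × x ~ y × Walk _~_ j y w × i + suc j ≡ d v w

  OnShortestPath : (v x y : Fin n) → Set
  OnShortestPath v x y =
    ∃ λ w → w ≢ v × (ShortestPathThrough v w x y ⊎ ShortestPathThrough v w y x)

  Certifies : (v x y : Fin n) → Set
  Certifies v x y = d v x ≢ d v y

  certifies? : ∀ v x y → Dec (Certifies v x y)
  certifies? v x y = ¬? (d v x ℕ.≟ d v y)

  d-refl : ∀ x → d x x ≡ 0
  d-refl x = ℕ.n≤0⇒n≡0 (d-min x x [])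

  d≡0⇒≡ : ∀ x y → d x y ≡ 0 → x ≡ y
  d≡0⇒≡ x y eq with d x y | d-walk x y
  d≡0⇒≡ x .x refl | .0 | [] = refl

  infixr 5 _++ʷ_
  _++ʷ_ : ∀ {i j x y z} → Walk _~_ i x y → Walk _~_ j y z → Walk _~_ (i + j) x z
  []      ++ʷ q = q
  (e ∷ p) ++ʷ q = e ∷ (p ++ʷ q)

  through⇒certifies : ∀ v w x y → ShortestPathThrough v w x y → Certifies v x y
  through⇒certifies v w x y (i , j , p , _ , q , i+1+j≡d) dx≡dy =
    ℕ.<-irrefl i+1+j≡d (begin-strict
      i + suc j    ≡⟨ i+1+j≡d ⟩
      d v w        ≤⟨ d-min v w (d-walk v y ++ʷ q) ⟩
      d v y + j    ≡⟨ cong (_+ j) dx≡dy ⟨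
      d v x + j    ≤⟨ ℕ.+-monoˡ-≤ j (d-min v x p) ⟩
      i + j        <⟨ ℕ.+-monoʳ-< i (ℕ.n<1+n j) ⟩
      i + suc j    ≡⟨ i+1+j≡d ⟩
      d v w        ∎)
      where
      open ℕ.≤-Reasoning

  farther⇒through : ∀ v x y → x ~ y → d v x < d v y →
                    y ≢ v × ShortestPathThrough v y x y
  farther⇒through v x y e dx<dy =
      (λ { refl → ℕ.n≮0 (subst (d v x <_) (d-refl v) dx<dy) })
    , d v x , 0 , d-walk v x , e , []
    , ℕ.≤-antisym (subst (_≤ d v y) (ℕ.+-comm 1 (d v x)) dx<dy)
                  (d-min v y (d-walk v x ++ʷ (e ∷ [])))

  onShortestPath⇒ : ∀ v x y → OnShortestPath v x y → x ~ y × Certifies v x y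
  onShortestPath⇒ v x y (w , _ , inj₁ t@(_ , _ , _ , e , _)) =
    e , through⇒certifies v w x y t
  onShortestPath⇒ v x y (w , _ , inj₂ t@(_ , _ , _ , e , _)) =
    ~-sym e , ≢-sym (through⇒certifies v w y x t)

  onShortestPath⇐ : ∀ v x y → x ~ y × Certifies v x y → OnShortestPath v x y
  onShortestPath⇐ v x y (e , dx≢dy) with d v x ℕ.<? d v y
  ... | yes lt = let y≢v , t = farther⇒through v x y e lt in y , y≢v , inj₁ t
  ... | no ¬lt =
    let gt      = ℕ.≤∧≢⇒< (ℕ.≮⇒≥ ¬lt) (≢-sym dx≢dy)
        x≢v , t = farther⇒through v y x (~-sym e) gt
    in x , x≢v , inj₂ t

  onShortestPath? : ∀ v x y → Dec (OnShortestPath v x y)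
  onShortestPath? v x y =
    map′ (onShortestPath⇐ v x y) (onShortestPath⇒ v x y)
         ((x ~? y) ×-dec certifies? v x y)

open Distance public using (d; OnShortestPath; onShortestPath?; Certifies; certifies?)

CertifiesAll : ConnectedGraph n → Pred (Fin n) 0ℓ → Set
CertifiesAll G Q = ∀ x y → x ≢ y → ∃ λ v → Q v × Certifies G v x y

certifiesAll? : (G : ConnectedGraph n) {Q : Pred (Fin n) 0ℓ} →
                Decidable Q → Dec (CertifiesAll G Q)
certifiesAll? G Q? = all? λ x → all? λ y →
  ¬? (x ≟ y) →-dec any? λ v → Q? v ×-dec certifies? G v x y

CertifiableWith : ConnectedGraph n → ℕ → Set
CertifiableWith {n} G k = ∃ λ (S : Subset n) → CertifiesAll G (_∈ₛ S) × ∣ S ∣ ≡ k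

certifiableWith? : (G : ConnectedGraph n) → Decidable (CertifiableWith G)
certifiableWith? G k =
  anySubset? λ S → certifiesAll? G (_∈ₛ? S) ×-dec (∣ S ∣ ℕ.≟ k)

certifiable : (G : ConnectedGraph n) → ∃ (CertifiableWith G)
certifiable {n} G = ∣ ⊤ {n} ∣ , ⊤ , all , refl
  where
  open Distance G using (d-refl; d≡0⇒≡)
  all : CertifiesAll G (_∈ₛ ⊤)
  all x y x≢y = x , ∈⊤ , λ eq → x≢y (d≡0⇒≡ x y (trans (sym eq) (d-refl x)))

OPT : ConnectedGraph n → ℕ
OPT G = proj₁ (least (certifiableWith? G) _ (proj₂ (certifiable G)))

-- An answer is the indicator function of a set of edges.
Answer : ℕ → Set
Answer n = Fin n → Fin n → Bool

answer : ConnectedGraph n → Fin n → Answer n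
answer G v x y = does (onShortestPath? G v x y)

-- A randomized online algorithm as a decision tree: the position in the tree
-- records exactly the answers and the fair random bits seen so far, so every
-- query depends on nothing else.
data Algorithm (n : ℕ) : Set where
  stop  : Algorithm n
  query : Fin n → (Answer n → Algorithm n) → Algorithm n
  toss  : (Bool → Algorithm n) → Algorithm n

-- The probability, over the fair coin tosses of the algorithm run on G, that
-- the list of all queries made (most recent first, repetitions kept)
-- satisfies the given event; the list argument holds the queries made so far.
PrFrom : ConnectedGraph n → {P : Pred (List (Fin n)) ℓ} → Decidable P →
         List (Fin n) → Algorithm n → ℚ
PrFrom G P? qs stop        = if does (P? qs) then 1ℚ else 0ℚ
PrFrom G P? qs (query v k) = PrFrom G P? (v ∷ qs) (k (answer G v))
PrFrom G P? qs (toss k)    =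
  ½ ℚ.* (PrFrom G P? qs (k true) ℚ.+ PrFrom G P? qs (k false))

Pr : ConnectedGraph n → Algorithm n → {P : Pred (List (Fin n)) ℓ} → Decidable P → ℚ
Pr G A P? = PrFrom G P? [] A

WithHighProbability : ∀ n .{{_ : NonTrivial n}} → ConnectedGraph n → Algorithm n →
                      {P : Pred (List (Fin n)) ℓ} → Decidable P → Set
WithHighProbability n G A P? =
  1ℚ ℚ.- (_/_ (+ 1) n {{nonTrivial⇒nonZero n}}) ℚ.≤ Pr G A P?

{-# OPTIONS --safe #-}

-- Querying both x and y reveals the whole set S(x,y) of queries that certify the pair {x,y}, so the
-- problem becomes online hitting set for these sets and is solved by multiplicative weights with
-- randomized rounding.  All weights start at 1, and N is a power of 2 with 2n ≤ N = O(n).  As long as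
-- some pair is uncertified, query both its vertices; if S(x,y) weighs less than N, draw O(log n)
-- vertices, each v ∈ S(x,y) with probability weight(v)/N, query them, and double the weights in S(x,y).
--
-- Each such round doubles the weight of some vertex of an optimal certificate, and a vertex of a set
-- lighter than N doubles at most log N times; hence there are O(OPT log n) rounds of O(log n) queries.
-- The algorithm gets stuck only on an uncertified pair whose set weighs at least N.  For a pair
-- whose set weighs W, [uncertified] · ((N + W) / 2N)^L, with L draws per round, is a
-- supermartingale that is at least 1 when the algorithm gets stuck on the pair and at most (3/4)^L
-- at the start; a union bound over the pairs finishes the proof.

module Submission where

open import Defs
open import Algebra.Bundles using (CommutativeRing)
import Algebra.Properties.Semiring.Mult as Mult
open import Data.Bool.Base using (true; false; if_then_else_)
import Data.Bool.Properties as Bool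
open import Data.Fin.Base using (Fin; zero; suc; toℕ)
open import Data.Fin.Properties using (_≟_; any?; toℕ-injective; toℕ≤pred[n]; injective⇒≤)
open import Data.Fin.Subset using (Subset; ∣_∣) renaming (_∈_ to _∈ₛ_)
open import Data.Fin.Subset.Properties using (∣p∣≤n)
import Data.Integer.Base as ℤ
import Data.Integer.Properties as ℤ
open import Data.List.Base
  using (List; []; _∷_; _++_; length; map; filter; take; drop; allFin; cartesianProduct)
open import Data.List.Membership.DecPropositional using (_∈?_)
open import Data.List.Membership.Propositional using (_∈_; find)
open import Data.List.Membership.Propositional.Properties
  using (∈-map⁺; ∈-allFin; ∈-cartesianProduct⁺; ∈-filter⁺; ∈-length)
import Data.List.Properties as List
open import Data.List.Relation.Unary.All using (All; []; _∷_; all?)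
import Data.List.Relation.Unary.All.Properties as All
open import Data.List.Relation.Unary.Any using (here; there)
import Data.List.Relation.Unary.Any.Properties as Any
open import Data.Nat.Base
  using (ℕ; zero; suc; _+_; _*_; _∸_; _^_; _≤_; _<_; z≤n; s≤s; s≤s⁻¹; NonZero; NonTrivial;
         nonTrivial⇒nonZero; nonTrivial⇒n>1; >-nonZero; ≢-nonZero; ≢-nonZero⁻¹)
open import Data.Nat.ListAction using (sum; product)
open import Data.Nat.Logarithm using (⌊log₂_⌋; ⌊log₂⌋-mono-≤; ⌊log₂[2^n]⌋≡n)
import Data.Nat.Properties as ℕ
open import Data.Nat.Properties using (_≤?_)
open import Data.Nat.Tactic.RingSolver using (solve-∀)
open import Data.Product.Base using (∃; Σ; _×_; _,_; proj₁; proj₂)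
open import Data.Rational.Base as ℚ using (ℚ; 0ℚ; 1ℚ; ½; _/_)
import Data.Rational.Properties as ℚ
open import Data.Rational.Solver using (module +-*-Solver)
import Data.Rational.Unnormalised.Base as ℚᵘ
import Data.Rational.Unnormalised.Properties as ℚᵘ
open import Data.Sum.Base using (inj₁; inj₂)
open import Data.Vec.Base using ([]; _∷_; here; there)
open import Function.Base using (_∘_; const)
open import Level using (0ℓ)
open import Relation.Binary.PropositionalEquality
  using (_≡_; _≢_; refl; sym; trans; cong; cong₂; subst; module ≡-Reasoning)
open import Relation.Nullary.Decidable
  using (Dec; yes; no; does; ¬?; _×-dec_; _⊎-dec_; dec-true; toWitness)
open import Relation.Nullary.Negation using (¬_; contradiction)
open import Relation.Unary using (Pred; Decidable)

private variable
  n : ℕ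
  A : Set

does⇒ : {X : Set} (X? : Dec X) → does X? ≡ true → X
does⇒ (yes x) _ = x

+-interchange : ∀ a b c d → a + b + (c + d) ≡ a + c + (b + d)
+-interchange = solve-∀

-- Sums over a list

Σ[_]_ : List A → (A → ℕ) → ℕ
Σ[ xs ] f = sum (map f xs)

infix 5 Σ[_]_

Σ-mono : (xs : List A) {f g : A → ℕ} → (∀ x → f x ≤ g x) → (Σ[ xs ] f) ≤ (Σ[ xs ] g)
Σ-mono []       f≤g = z≤n
Σ-mono (x ∷ xs) f≤g = ℕ.+-mono-≤ (f≤g x) (Σ-mono xs f≤g)

Σ-mono-< : ∀ {xs : List A} {x} {f g : A → ℕ} → x ∈ xs → (∀ x → f x ≤ g x) → f x < g x →
           (Σ[ xs ] f) < (Σ[ xs ] g)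
Σ-mono-< {xs = _ ∷ xs} (here refl) f≤g fx<gx = ℕ.+-mono-<-≤ fx<gx (Σ-mono xs f≤g)
Σ-mono-< {xs = y ∷ _}  (there x∈)  f≤g fx<gx = ℕ.+-mono-≤-< (f≤g y) (Σ-mono-< x∈ f≤g fx<gx)

Σ-+ : (xs : List A) (f g : A → ℕ) → (Σ[ xs ] f) + (Σ[ xs ] g) ≡ (Σ[ xs ] λ x → f x + g x)
Σ-+ []       f g = refl
Σ-+ (x ∷ xs) f g = begin
  f x + (Σ[ xs ] f) + (g x + (Σ[ xs ] g))  ≡⟨ +-interchange (f x) _ (g x) _ ⟩
  f x + g x + ((Σ[ xs ] f) + (Σ[ xs ] g))  ≡⟨ cong (f x + g x +_) (Σ-+ xs f g) ⟩
  f x + g x + (Σ[ xs ] λ x → f x + g x)    ∎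
  where open ≡-Reasoning

Σ-*ʳ : (xs : List A) (f : A → ℕ) (c : ℕ) → (Σ[ xs ] λ x → f x * c) ≡ (Σ[ xs ] f) * c
Σ-*ʳ []       f c = refl
Σ-*ʳ (x ∷ xs) f c =
  trans (cong (f x * c +_) (Σ-*ʳ xs f c)) (sym (ℕ.*-distribʳ-+ c (f x) (Σ[ xs ] f)))

Σ-const : (xs : List A) (c : ℕ) → (Σ[ xs ] const c) ≡ length xs * c
Σ-const []       c = refl
Σ-const (x ∷ xs) c = cong (c +_) (Σ-const xs c)

term≤Σ : ∀ {xs : List A} {x} (f : A → ℕ) → x ∈ xs → f x ≤ (Σ[ xs ] f)
term≤Σ f (here refl) = ℕ.m≤m+n _ _
term≤Σ f (there x∈)  = ℕ.≤-trans (term≤Σ f x∈) (ℕ.m≤n+m _ _)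

-- Counting

count : {P : Pred A 0ℓ} → Decidable P → List A → ℕ
count P? xs = length (filter P? xs)

count-++ : {P : Pred A 0ℓ} (P? : Decidable P) (xs ys : List A) →
           count P? (xs ++ ys) ≡ count P? xs + count P? ys
count-++ P? xs ys = trans (cong length (List.filter-++ P? xs ys)) (List.length-++ (filter P? xs))

count-mono : {P Q : Pred A 0ℓ} (P? : Decidable P) (Q? : Decidable Q) → (∀ x → P x → Q x) →
             (xs : List A) → count P? xs ≤ count Q? xs
count-mono P? Q? P⊆Q []       = z≤n
count-mono P? Q? P⊆Q (x ∷ xs) with P? x | Q? x
... | yes _ | yes _ = s≤s (count-mono P? Q? P⊆Q xs)
... | yes p | no ¬q = contradiction (P⊆Q x p) ¬q
... | no _  | yes _ = ℕ.m≤n⇒m≤1+n (count-mono P? Q? P⊆Q xs)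
... | no _  | no _  = count-mono P? Q? P⊆Q xs

count-filter : {P Q : Pred A 0ℓ} (P? : Decidable P) (Q? : Decidable Q) → (∀ x → P x → Q x) →
               (xs : List A) → count P? xs ≤ count P? (filter Q? xs)
count-filter P? Q? P⊆Q []       = z≤n
count-filter P? Q? P⊆Q (x ∷ xs) with Q? x
... | yes _ with P? x
...   | yes _ = s≤s (count-filter P? Q? P⊆Q xs)
...   | no _  = count-filter P? Q? P⊆Q xs
count-filter P? Q? P⊆Q (x ∷ xs) | no ¬q with P? x
...   | yes p = contradiction (P⊆Q x p) ¬q
...   | no _  = count-filter P? Q? P⊆Q xs

elements : Subset n → List (Fin n)
elements []          = []
elements (true  ∷ p) = zero ∷ map suc (elements p)
elements (false ∷ p) = map suc (elements p)

length-elements : (p : Subset n) → length (elements p) ≡ ∣ p ∣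
length-elements []          = refl
length-elements (true  ∷ p) = cong suc (trans (List.length-map suc (elements p)) (length-elements p))
length-elements (false ∷ p) = trans (List.length-map suc (elements p)) (length-elements p)

∈-elements : ∀ {x} (p : Subset n) → x ∈ₛ p → x ∈ elements p
∈-elements (true  ∷ p) here        = here refl
∈-elements (true  ∷ p) (there x∈p) = there (∈-map⁺ suc (∈-elements p x∈p))
∈-elements (false ∷ p) (there x∈p) = ∈-map⁺ suc (∈-elements p x∈p)

-- Distances from answers

-- Walks grow at the far end because the answer at `v` shows the last edge of every shortest path
-- from `v`, and removing that edge leaves a shortest path from `v` again.
Reach : Answer n → ℕ → Fin n → Fin n → Set
Reach ans zero    x z = x ≡ z
Reach ans (suc k) x z = ∃ λ y → Reach ans k x y × ans y z ≡ true

reach? : (ans : Answer n) → ∀ k x z → Dec (Reach ans k x z)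
reach? ans zero    x z = x ≟ z
reach? ans (suc k) x z = any? λ y → reach? ans k x y ×-dec (ans y z Bool.≟ true)

-- The disjunct k ≡ n only makes the search total: it is not reached on the
-- answers given by a connected graph on n vertices.
dist : Answer n → Fin n → Fin n → ℕ
dist {n} ans x y =
  proj₁ (least (λ k → reach? ans k x y ⊎-dec (k ℕ.≟ n)) n (inj₂ refl))

module Layers {n : ℕ} (G : ConnectedGraph n) where
  open ConnectedGraph G
  open Distance G using (d-walk; d-min; d≡0⇒≡; onShortestPath⇒; onShortestPath⇐)

  snoc : ∀ {k x y z} → Walk _~_ k x y → y ~ z → Walk _~_ (suc k) x z
  snoc []      e = e ∷ []
  snoc (f ∷ w) e = f ∷ snoc w e

  unsnoc : ∀ {k x z} → Walk _~_ (suc k) x z → ∃ λ y → Walk _~_ k x y × y ~ z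
  unsnoc (e ∷ [])    = _ , [] , e
  unsnoc (e ∷ f ∷ w) = let y , w′ , e′ = unsnoc (f ∷ w) in y , e ∷ w′ , e′

  reverse : ∀ {k x y} → Walk _~_ k x y → Walk _~_ k y x
  reverse []      = []
  reverse (e ∷ w) = snoc (reverse w) (~-sym e)

  d-sym : ∀ x y → d G x y ≡ d G y x
  d-sym x y = ℕ.≤-antisym (d-min x y (reverse (d-walk y x))) (d-min y x (reverse (d-walk x y)))

  -- Cut off the last edge of a shortest walk. A shorter walk to `z`, extended by that edge, would
  -- beat `d G v y`.
  predecessor : ∀ {v y k} → d G v y ≡ suc k → ∃ λ z → d G v z ≡ k × z ~ y
  predecessor {v} {y} dvy≡1+k =
    let z , w , e = unsnoc (subst (λ k → Walk _~_ k v y) dvy≡1+k (d-walk v y))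
    in z , ℕ.≤-antisym (d-min v z w)
             (s≤s⁻¹ (subst (_≤ suc (d G v z)) dvy≡1+k (d-min v y (snoc (d-walk v z) e)))) , e

  level : ∀ {v} k y → d G v y ≡ k → ∀ {i} → i ≤ k → ∃ λ z → d G v z ≡ i
  level k y dvy≡k {i} i≤k with i ℕ.≟ k
  ... | yes refl = y , dvy≡k
  level zero    y dvy≡k z≤n | no 0≢0 = contradiction refl 0≢0
  level (suc k) y dvy≡k i≤k | no i≢k =
    let z , dvz≡k , _ = predecessor dvy≡k in level k z dvz≡k (s≤s⁻¹ (ℕ.≤∧≢⇒< i≤k i≢k))

  -- Every level from 0 to `d G v y` is occupied, and vertices on different levels are distinct.
  d<n : ∀ v y → d G v y < n
  d<n v y = injective⇒≤ {f = proj₁ ∘ at} λ {i} {j} eq → toℕ-injective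
    (trans (sym (proj₂ (at i))) (trans (cong (d G v) eq) (proj₂ (at j))))
    where
    at : (i : Fin (suc (d G v y))) → ∃ λ z → d G v z ≡ toℕ i
    at i = level (d G v y) y refl (toℕ≤pred[n] i)

  reach⇒walk : ∀ {v} k {x y} → Reach (answer G v) k x y → Walk _~_ k x y
  reach⇒walk     zero    refl         = []
  reach⇒walk {v} (suc k) (z , r , eq) =
    snoc (reach⇒walk k r) (proj₁ (onShortestPath⇒ v z _ (does⇒ (onShortestPath? G v z _) eq)))

  -- Consecutive vertices of a shortest path from `v` lie in different layers, so the query at `v`
  -- reveals all its edges.
  d⇒reach : ∀ {v} k {y} → d G v y ≡ k → Reach (answer G v) k v y
  d⇒reach {v} zero    {y} dvy≡0   = d≡0⇒≡ v y dvy≡0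
  d⇒reach {v} (suc k) {y} dvy≡1+k =
    let z , dvz≡k , e = predecessor dvy≡1+k
    in z , d⇒reach k dvz≡k , dec-true (onShortestPath? G v z y)
         (onShortestPath⇐ v z y
           (e , λ eq → ℕ.1+n≢n (trans (sym dvy≡1+k) (trans (sym eq) dvz≡k))))

  dist≡d : ∀ v y → dist (answer G v) v y ≡ d G v y
  dist≡d v y with least (λ k → reach? (answer G v) k v y ⊎-dec (k ℕ.≟ n)) n (inj₂ refl)
  ... | m , inj₁ r , min = ℕ.≤-antisym (min _ (inj₁ (d⇒reach _ refl))) (d-min v y (reach⇒walk m r))
  -- Minimality still gives `m ≤ d`; the other inequality comes from `d<n`.
  ... | m , inj₂ m≡n , min =
    ℕ.≤-antisym (min _ (inj₁ (d⇒reach _ refl))) (subst (d G v y ≤_) (sym m≡n) (ℕ.<⇒≤ (d<n v y)))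

-- The naturals inside ℚ

open Mult (CommutativeRing.semiring ℚ.+-*-commutativeRing)
  using (×-homo-+; ×1-homo-*) renaming (_×_ to _·_)

-- As a multiple of `1ℚ`, compatibility with sums and products comes from the theory of semirings.
ι : ℕ → ℚ
ι k = k · 1ℚ

0≤ι : ∀ k → 0ℚ ℚ.≤ ι k
0≤ι zero    = ℚ.≤-refl
0≤ι (suc k) = ℚ.+-mono-≤ {0ℚ} {1ℚ} (ℚ.nonNegative⁻¹ 1ℚ) (0≤ι k)

ι-nonNegative : ∀ k → ℚ.NonNegative (ι k)
ι-nonNegative k = ℚ.nonNegative (0≤ι k)

ι-positive : ∀ k .{{_ : NonZero k}} → ℚ.Positive (ι k)
ι-positive (suc k) = ℚ.pos+nonNeg⇒pos 1ℚ (ι k) {{ι-nonNegative k}}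

ι-mono : ∀ {j k} → j ≤ k → ι j ℚ.≤ ι k
ι-mono {k = k} z≤n = 0≤ι k
ι-mono (s≤s j≤k)   = ℚ.+-monoʳ-≤ 1ℚ (ι-mono j≤k)

toℚᵘ-ι : ∀ k → ℚ.toℚᵘ (ι k) ℚᵘ.≃ ℚᵘ.mkℚᵘ (ℤ.+ k) 0
toℚᵘ-ι zero    = ℚᵘ.≃-refl
toℚᵘ-ι (suc k) = begin
  ℚ.toℚᵘ (1ℚ ℚ.+ ι k)                ≈⟨ ℚ.toℚᵘ-homo-+ 1ℚ (ι k) ⟩
  ℚᵘ.1ℚᵘ ℚᵘ.+ ℚ.toℚᵘ (ι k)           ≈⟨ ℚᵘ.+-congʳ ℚᵘ.1ℚᵘ (toℚᵘ-ι k) ⟩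
  ℚᵘ.1ℚᵘ ℚᵘ.+ ℚᵘ.mkℚᵘ (ℤ.+ k) 0      ≈⟨ ℚᵘ.*≡* (cong (λ i → (ℤ.1ℤ ℤ.+ i) ℤ.* ℤ.1ℤ)
                                                    (ℤ.*-identityʳ (ℤ.+ k))) ⟩
  ℚᵘ.mkℚᵘ (ℤ.+ suc k) 0              ∎
  where open ℚᵘ.≃-Reasoning

ι-inverse : ∀ k .{{_ : NonZero k}} → ι k ℚ.* (ℤ.+ 1 / k) ≡ 1ℚ
ι-inverse (suc k) = ℚ.toℚᵘ-injective (begin
  ℚ.toℚᵘ (ι (suc k) ℚ.* (ℤ.+ 1 / suc k))
    ≈⟨ ℚ.toℚᵘ-homo-* (ι (suc k)) (ℤ.+ 1 / suc k) ⟩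
  ℚ.toℚᵘ (ι (suc k)) ℚᵘ.* ℚ.toℚᵘ (ℤ.+ 1 / suc k)
    ≈⟨ ℚᵘ.*-cong (toℚᵘ-ι (suc k)) (ℚ.toℚᵘ-fromℚᵘ (ℚᵘ.mkℚᵘ (ℤ.+ 1) k)) ⟩
  ℚᵘ.mkℚᵘ (ℤ.+ suc k) 0 ℚᵘ.* ℚᵘ.mkℚᵘ (ℤ.+ 1) k
    ≈⟨ ℚᵘ.*≡* (trans (trans (ℤ.*-identityʳ _) (ℤ.*-identityʳ _))
                     (sym (trans (ℤ.*-identityˡ _) (ℤ.*-identityˡ (ℤ.+ suc k))))) ⟩
  ℚᵘ.1ℚᵘ ∎)
  where open ℚᵘ.≃-Reasoning

-- Calculus of failure probabilities.

module _ {n : ℕ} (G : ConnectedGraph n) {P : Pred (List (Fin n)) 0ℓ} (P? : Decidable P) where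

  -- The probability of missing the event is at most u / M, cleared of denominators.
  record Risk (A : Algorithm n) (qs : List (Fin n)) (u M : ℕ) : Set where
    constructor risk
    field bound : ι M ℚ.≤ ι M ℚ.* PrFrom G P? qs A ℚ.+ ι u

  open Risk public

  -- A fair toss averages the two bounds: the mean of `u / M` and `v / M` is `(u + v) / (M + M)`.
  risk-toss : ∀ {k qs u v M} → Risk (k true) qs u M → Risk (k false) qs v M →
              Risk (toss k) qs (u + v) (M + M)
  risk-toss {k} {qs} {u} {v} {M} (risk r) (risk s) = risk (begin
    ι (M + M)
      ≡⟨ ×-homo-+ 1ℚ M M ⟩
    ι M ℚ.+ ι M
      ≤⟨ ℚ.+-mono-≤ r s ⟩
    (ι M ℚ.* p ℚ.+ ι u) ℚ.+ (ι M ℚ.* q ℚ.+ ι v)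
      ≡⟨ half (ι M) p q (ι u) (ι v) ⟩
    (ι M ℚ.+ ι M) ℚ.* (½ ℚ.* (p ℚ.+ q)) ℚ.+ (ι u ℚ.+ ι v)
      ≡⟨ cong₂ (λ x y → x ℚ.* (½ ℚ.* (p ℚ.+ q)) ℚ.+ y) (×-homo-+ 1ℚ M M) (×-homo-+ 1ℚ u v) ⟨
    ι (M + M) ℚ.* (½ ℚ.* (p ℚ.+ q)) ℚ.+ ι (u + v) ∎)
    where
    open ℚ.≤-Reasoning
    open +-*-Solver
    p = PrFrom G P? qs (k true)
    q = PrFrom G P? qs (k false)
    half : ∀ m p q u v → (m ℚ.* p ℚ.+ u) ℚ.+ (m ℚ.* q ℚ.+ v) ≡
                         (m ℚ.+ m) ℚ.* (½ ℚ.* (p ℚ.+ q)) ℚ.+ (u ℚ.+ v)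
    half = solve 5 (λ m p q u v → (m :* p :+ u) :+ (m :* q :+ v) :=
                                  (m :+ m) :* (con ½ :* (p :+ q)) :+ (u :+ v)) refl

  risk-query : ∀ {v k qs u M} → Risk (k (answer G v)) (v ∷ qs) u M → Risk (query v k) qs u M
  risk-query (risk r) = risk r

  -- The hypothesis is `u / M ≤ u′ / M′` cross-multiplied. The inequality is proved after
  -- multiplication by `ι M`, which is then cancelled.
  risk-weaken : ∀ {A qs u M u′ M′} .{{_ : NonZero M}} → u * M′ ≤ u′ * M →
                Risk A qs u M → Risk A qs u′ M′
  risk-weaken {A} {qs} {u} {M} {u′} {M′} u/M≤u′/M′ (risk r) =
    risk (ℚ.*-cancelˡ-≤-pos (ι M) {{ι-positive M}} (begin
    ι M ℚ.* ι M′                                 ≤⟨ ℚ.*-monoʳ-≤-nonNeg (ι M′) {{ι-nonNegative M′}} r ⟩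
    (ι M ℚ.* p ℚ.+ ι u) ℚ.* ι M′                 ≡⟨ expand (ι M) p (ι u) (ι M′) ⟩
    ι M ℚ.* (ι M′ ℚ.* p) ℚ.+ ι u ℚ.* ι M′        ≡⟨ cong (ι M ℚ.* (ι M′ ℚ.* p) ℚ.+_) (×1-homo-* u M′) ⟨
    ι M ℚ.* (ι M′ ℚ.* p) ℚ.+ ι (u * M′)          ≤⟨ ℚ.+-monoʳ-≤ (ι M ℚ.* (ι M′ ℚ.* p)) (ι-mono u/M≤u′/M′) ⟩
    ι M ℚ.* (ι M′ ℚ.* p) ℚ.+ ι (u′ * M)          ≡⟨ cong (ι M ℚ.* (ι M′ ℚ.* p) ℚ.+_) (×1-homo-* u′ M) ⟩
    ι M ℚ.* (ι M′ ℚ.* p) ℚ.+ ι u′ ℚ.* ι M        ≡⟨ collect (ι M) p (ι u′) (ι M′) ⟩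
    ι M ℚ.* (ι M′ ℚ.* p ℚ.+ ι u′)                ∎))
    where
    open ℚ.≤-Reasoning
    open +-*-Solver
    p = PrFrom G P? qs A
    expand : ∀ m p u m′ → (m ℚ.* p ℚ.+ u) ℚ.* m′ ≡ m ℚ.* (m′ ℚ.* p) ℚ.+ u ℚ.* m′
    expand = solve 4 (λ m p u m′ → (m :* p :+ u) :* m′ := m :* (m′ :* p) :+ u :* m′) refl
    collect : ∀ m p u m′ → m ℚ.* (m′ ℚ.* p) ℚ.+ u ℚ.* m ≡ m ℚ.* (m′ ℚ.* p ℚ.+ u)
    collect = solve 4 (λ m p u m′ → m :* (m′ :* p) :+ u :* m := m :* (m′ :* p :+ u)) refl

  risk-mono : ∀ {A qs u u′ M} → u ≤ u′ → Risk A qs u M → Risk A qs u′ M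
  risk-mono {A} {qs} {M = M} u≤u′ (risk r) =
    risk (ℚ.≤-trans r (ℚ.+-monoʳ-≤ (ι M ℚ.* PrFrom G P? qs A) (ι-mono u≤u′)))

  risk-certain : ∀ {qs u M} → P qs → Risk stop qs u M
  risk-certain {qs} {u} {M} p = risk (begin
    ι M                                     ≡⟨ ℚ.*-identityʳ (ι M) ⟨
    ι M ℚ.* 1ℚ                              ≡⟨ ℚ.+-identityʳ (ι M ℚ.* 1ℚ) ⟨
    ι M ℚ.* 1ℚ ℚ.+ 0ℚ                       ≤⟨ ℚ.+-monoʳ-≤ (ι M ℚ.* 1ℚ) (0≤ι u) ⟩
    ι M ℚ.* 1ℚ ℚ.+ ι u                      ≡⟨ cong (λ b → ι M ℚ.* (if b then 1ℚ else 0ℚ) ℚ.+ ι u)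
                                                    (dec-true (P? qs) p) ⟨
    ι M ℚ.* PrFrom G P? qs stop ℚ.+ ι u     ∎)
    where open ℚ.≤-Reasoning hiding (stop)

  PrFrom-nonNegative : ∀ A qs → 0ℚ ℚ.≤ PrFrom G P? qs A
  PrFrom-nonNegative stop qs with does (P? qs)
  ... | true  = ℚ.nonNegative⁻¹ 1ℚ
  ... | false = ℚ.≤-refl
  PrFrom-nonNegative (query v k) qs = PrFrom-nonNegative (k (answer G v)) (v ∷ qs)
  PrFrom-nonNegative (toss k)    qs =
    ℚ.*-monoˡ-≤-nonNeg ½ (ℚ.+-mono-≤ (PrFrom-nonNegative (k true) qs) (PrFrom-nonNegative (k false) qs))

  -- A failure bound of at least 1 holds for any algorithm; this covers the runs that get stuck.
  risk-trivial : ∀ {A qs u M} → M ≤ u → Risk A qs u M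
  risk-trivial {A} {qs} {u} {M} M≤u = risk (begin
    ι M                                   ≤⟨ ι-mono M≤u ⟩
    ι u                                   ≡⟨ ℚ.+-identityˡ (ι u) ⟨
    0ℚ ℚ.+ ι u                            ≡⟨ cong (ℚ._+ ι u) (ℚ.*-zeroʳ (ι M)) ⟨
    ι M ℚ.* 0ℚ ℚ.+ ι u                    ≤⟨ ℚ.+-monoˡ-≤ (ι u) (ℚ.*-monoˡ-≤-nonNeg (ι M) {{ι-nonNegative M}}
                                               (PrFrom-nonNegative A qs)) ⟩
    ι M ℚ.* PrFrom G P? qs A ℚ.+ ι u      ∎)
    where open ℚ.≤-Reasoning

  risk-if : ∀ {X : Set} {A B qs u M} (X? : Dec X) → (X → Risk A qs u M) → (¬ X → Risk B qs u M) →
            Risk (if does X? then A else B) qs u M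
  risk-if (yes x) r s = r x
  risk-if (no ¬x) r s = s ¬x

  risk⇒whp : .{{_ : NonTrivial n}} → ∀ {A u M} .{{_ : NonZero M}} → u * n ≤ M →
             Risk A [] u M → WithHighProbability n G A P?
  risk⇒whp {A} {u} {M} un≤M r = ℚ.*-cancelˡ-≤-pos (ι n) {{ι-positive n}} (begin
    ι n ℚ.* (1ℚ ℚ.- 1/n)                         ≡⟨ expand (ι n) 1/n ⟩
    ι n ℚ.- ι n ℚ.* 1/n                          ≡⟨ cong (λ q → ι n ℚ.- q) (ι-inverse n) ⟩
    ι n ℚ.- 1ℚ                                   ≤⟨ ℚ.+-monoˡ-≤ (ℚ.- 1ℚ) (bound (risk-weaken {u′ = 1} un≤1M r)) ⟩
    ι n ℚ.* Pr G A P? ℚ.+ ι 1 ℚ.- 1ℚ             ≡⟨ collapse (ι n ℚ.* Pr G A P?) ⟩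
    ι n ℚ.* Pr G A P?                            ∎)
    where
    open ℚ.≤-Reasoning
    open +-*-Solver
    instance
      n≢0 : NonZero n
      n≢0 = nonTrivial⇒nonZero n
    un≤1M : u * n ≤ 1 * M
    un≤1M = ℕ.≤-trans un≤M (ℕ.≤-reflexive (sym (ℕ.*-identityˡ M)))
    1/n : ℚ
    1/n = ℤ.+ 1 / n
    expand : ∀ m q → m ℚ.* (1ℚ ℚ.- q) ≡ m ℚ.- m ℚ.* q
    expand = solve 2 (λ m q → m :* (con 1ℚ :- q) := m :- m :* q) refl
    collapse : ∀ p → p ℚ.+ (1ℚ ℚ.+ 0ℚ) ℚ.- 1ℚ ≡ p
    collapse = solve 1 (λ p → p :+ (con 1ℚ :+ con 0ℚ) :- con 1ℚ := p) refl

-- Weighted sampling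

-- With `j` tosses each of `2 ^ j` positions is equally likely, so a vertex is drawn with
-- probability its multiplicity over `2 ^ j`. Positions past the end of the list yield the default
-- `x`.
sample : ∀ {n} → ℕ → List (Fin n) → Fin n → (Fin n → Algorithm n) → Algorithm n
sample zero    []       x k = k x
sample zero    (v ∷ _)  x k = k v
sample (suc j) xs       x k =
  toss λ b → sample j (if b then take (2 ^ j) xs else drop (2 ^ j) xs) x k

-- The algorithm, and the arithmetic of one round.

Row : ℕ → Set
Row n = Fin n → ℕ

-- A row holds the distances from one queried vertex, so these are the pairs that no query so far
-- certifies.
Unresolved : ∀ {n} → List (Row n) → Fin n → Fin n → Set
Unresolved rows x y = x ≢ y × All (λ row → row x ≡ row y) rows

unresolved? : ∀ {n} (rows : List (Row n)) → Dec (∃ λ x → ∃ λ y → Unresolved rows x y)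
unresolved? rows =
  any? λ x → any? λ y → ¬? (x ≟ y) ×-dec all? (λ row → row x ℕ.≟ row y) rows

-- On the rows of `x` and `y` this decides, by symmetry of the distance, which vertices certify the
-- pair.
differ? : ∀ {n} (r s : Row n) → Decidable (λ v → r v ≢ s v)
differ? r s v = ¬? (r v ℕ.≟ s v)

-- The pool is a multiset of vertices, the multiplicity of a vertex being its weight.
module Discovery (n m L : ℕ) where

  samples : ℕ → List (Fin n) → Fin n → List (Row n) → (List (Row n) → Algorithm n) → Algorithm n
  samples zero    xs x rows k = k rows
  samples (suc i) xs x rows k =
    sample m xs x λ v → query v λ a → samples i xs x (dist a v ∷ rows) k

  run : ℕ → List (Row n) → List (Fin n) → Algorithm n
  run zero    rows pool = stop
  run (suc f) rows pool with unresolved? rows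
  ... | no _            = stop
  ... | yes (x , y , _) = query x λ a → query y λ b →
    let xs = filter (differ? (dist a x) (dist b y)) pool in
    -- A set of weight `2 ^ m` or more counts as failure: the run gives up.
    if does (length xs ℕ.<? 2 ^ m)
      -- `xs` contains all copies of its vertices in the pool, so appending it doubles exactly their
      -- weights.
      then samples L xs x (dist b y ∷ dist a x ∷ rows) (λ rows′ → run f rows′ (xs ++ pool))
      else stop

-- A draw misses a set with probability (N ∸ δ) / N, which pays for the increase of its weight from W to δ + W.
potential-step : ∀ N W δ → δ ≤ N → (N + (δ + W)) * (N ∸ δ) ≤ (N + W) * N
potential-step N W δ δ≤N = subst (λ N → (N + (δ + W)) * (N ∸ δ) ≤ (N + W) * N)
  (ℕ.m+[n∸m]≡n δ≤N) (go (N ∸ δ))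
  where
  expand : ∀ δ k W → (δ + k + (δ + W)) * k + δ * (δ + W) ≡ (δ + k + W) * (δ + k)
  expand = solve-∀
  go : ∀ k → (δ + k + (δ + W)) * (δ + k ∸ δ) ≤ (δ + k + W) * (δ + k)
  go k rewrite ℕ.m+n∸m≡n δ k =
    ℕ.≤-trans (ℕ.m≤m+n _ (δ * (δ + W))) (ℕ.≤-reflexive (expand δ k W))

^-distribʳ-* : ∀ k a b → (a * b) ^ k ≡ a ^ k * b ^ k
^-distribʳ-* zero    a b = refl
^-distribʳ-* (suc k) a b = trans (cong (a * b *_) (^-distribʳ-* k a b)) (interchange a b (a ^ k) (b ^ k))
  where
  interchange : ∀ a b c d → a * b * (c * d) ≡ a * c * (b * d)
  interchange = solve-∀

∸-+-≤ : ∀ {N c d} → c ≤ N → d ≤ N → (N ∸ c) + (N ∸ d) ≤ N + N ∸ (c + d)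
∸-+-≤ {N} {c} {d} c≤N d≤N = ℕ.m+n≤o⇒m≤o∸n _ (ℕ.≤-reflexive (begin
  (N ∸ c) + (N ∸ d) + (c + d)    ≡⟨ +-interchange (N ∸ c) (N ∸ d) c d ⟩
  (N ∸ c + c) + (N ∸ d + d)      ≡⟨ cong₂ _+_ (ℕ.m∸n+n≡m c≤N) (ℕ.m∸n+n≡m d≤N) ⟩
  N + N                          ∎))
  where open ≡-Reasoning

-- A vertex of weight at least N / 2 ^ r v that lies in a set of weight below N has r v > 0,
-- so doubling its weight leaves r v ∸ 1 further doublings before it weighs N.
module Doubling {n N : ℕ} {S : Pred (Fin n) 0ℓ} (S? : Decidable S) (pool : List (Fin n)) (r : Fin n → ℕ)
  (weights : ∀ v → N ≤ count (v ≟_) pool * 2 ^ r v) (light : count S? pool < N) where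

  private
    xs = filter S? pool

  r′ : Fin n → ℕ
  r′ v = if does (S? v) then r v ∸ 1 else r v

  S-weight : ∀ v → S v → count (v ≟_) pool ≤ count (v ≟_) xs
  S-weight v Sv = count-filter (v ≟_) S? (λ { _ refl → Sv }) pool

  r-positive : ∀ v → S v → ∃ λ k → r v ≡ suc k
  r-positive v Sv with r v | weights v
  ... | suc k | _   = k , refl
  ... | zero  | N≤w = contradiction (subst (N ≤_) (ℕ.*-identityʳ _) N≤w)
    (ℕ.<⇒≱ (ℕ.≤-<-trans (ℕ.≤-trans (S-weight v Sv) (List.length-filter (v ≟_) xs)) light))

  weights′ : ∀ v → N ≤ count (v ≟_) (xs ++ pool) * 2 ^ r′ v
  weights′ v rewrite count-++ (v ≟_) xs pool with S? v
  ... | no _   = ℕ.≤-trans (weights v) (ℕ.*-monoˡ-≤ (2 ^ r v) (ℕ.m≤n+m (count (v ≟_) pool) (count (v ≟_) xs)))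
  ... | yes Sv with k , eq ← r-positive v Sv = begin
    N                                ≤⟨ weights v ⟩
    pooled * 2 ^ r v                 ≡⟨ cong (λ j → pooled * 2 ^ j) eq ⟩
    pooled * 2 ^ suc k               ≡⟨ double pooled (2 ^ k) ⟩
    -- The copies of `v` added by `xs` match those in the pool, which pays for the lost factor 2.
    (pooled + pooled) * 2 ^ k        ≤⟨ ℕ.*-monoˡ-≤ (2 ^ k) (ℕ.+-monoˡ-≤ pooled (S-weight v Sv)) ⟩
    (added + pooled) * 2 ^ k         ≡⟨ cong (λ j → (added + pooled) * 2 ^ (j ∸ 1)) eq ⟨
    (added + pooled) * 2 ^ (r v ∸ 1) ∎
    where
    open ℕ.≤-Reasoning
    pooled = count (v ≟_) pool
    added  = count (v ≟_) xs
    double : ∀ w p → w * (p + (p + 0)) ≡ (w + w) * p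
    double = solve-∀

  r′≤r : ∀ v → r′ v ≤ r v
  r′≤r v with does (S? v)
  ... | true  = ℕ.m∸n≤m (r v) 1
  ... | false = ℕ.≤-refl

  r′<r-at : ∀ v → S v → r′ v < r v
  r′<r-at v Sv with S? v
  ... | no ¬Sv = contradiction Sv ¬Sv
  ... | yes _ with k , eq ← r-positive v Sv rewrite eq = ℕ.≤-refl

-- Supermartingale analysis of a run.

pairs : ∀ n → List (Fin n × Fin n)
pairs n = cartesianProduct (allFin n) (allFin n)

module Analysis {n : ℕ} (G : ConnectedGraph n) {P : Pred (List (Fin n)) 0ℓ} (P? : Decidable P) where
  open Layers G

  row : Fin n → Row n
  row v = dist (answer G v) v

  Hits : Fin n × Fin n → Fin n → Set
  Hits (x , y) v = row v x ≢ row v y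

  hits? : ∀ e → Decidable (Hits e)
  hits? (x , y) v = ¬? (row v x ℕ.≟ row v y)

  -- The 0/1 indicator that the query at `v` fails to certify `e`, written in the form that the
  -- bound of `risk-sample` takes on a one-element list.
  miss : Fin n × Fin n → Fin n → ℕ
  miss e v = 1 ∸ count (hits? e) (v ∷ [])

  -- A product of indicators: 1 while no query certifies `e`, and 0 afterwards.
  survive : Fin n × Fin n → List (Fin n) → ℕ
  survive e qs = product (map (miss e) qs)

  survive-∷ : ∀ e v qs → survive e (v ∷ qs) ≤ survive e qs
  survive-∷ e v qs = subst (survive e (v ∷ qs) ≤_) (ℕ.*-identityˡ _)
    (ℕ.*-monoˡ-≤ (survive e qs) (ℕ.m∸n≤m 1 (count (hits? e) (v ∷ []))))

  survive-unresolved : ∀ x y qs → All (λ r → r x ≡ r y) (map row qs) → survive (x , y) qs ≡ 1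
  survive-unresolved x y []       []         = refl
  survive-unresolved x y (v ∷ qs) (eq ∷ eqs) = cong₂ _*_
    (cong (λ xs → 1 ∸ length xs) (List.filter-reject (hits? (x , y)) (λ neq → neq eq)))
    (survive-unresolved x y qs eqs)

  -- Averaging `miss e` over the `2 ^ j` positions counts those that do not hit `e`. The bound is
  -- linear in `miss`, so the average can be taken inside the sum, one halving of the list per toss.
  risk-sample : ∀ j xs {x k qs M} (c : Fin n × Fin n → ℕ) .{{_ : NonZero M}} →
    length xs ≤ 2 ^ j →
    (∀ v → Risk G P? (k v) qs (Σ[ pairs n ] λ e → c e * miss e v) M) →
    Risk G P? (sample j xs x k) qs
      (Σ[ pairs n ] λ e → c e * (2 ^ j ∸ count (hits? e) xs)) (M * 2 ^ j)
  -- An empty position is charged as a sure miss, whatever the default does.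
  risk-sample zero [] {x} {M = M} c _ r = subst (Risk G P? _ _ _) (sym (ℕ.*-identityʳ M))
    (risk-mono G P? (Σ-mono (pairs n) λ e → ℕ.*-monoʳ-≤ (c e) (ℕ.m∸n≤m 1 (count (hits? e) (x ∷ []))))
      (r x))
  risk-sample zero (v ∷ []) {M = M} c _ r =
    subst (Risk G P? _ _ _) (sym (ℕ.*-identityʳ M)) (r v)
  risk-sample zero (_ ∷ _ ∷ _) c (s≤s ()) r
  risk-sample (suc j) xs {x} {k} {qs} {M} c {{nzM}} len r = risk-weaken G P? {{nz}}
    (ℕ.*-mono-≤ bound′ (ℕ.≤-reflexive (double M (2 ^ j))))
    (risk-toss G P? (risk-sample j ts c lt r) (risk-sample j ds c ld r))
    where
    ts = take (2 ^ j) xs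
    ds = drop (2 ^ j) xs
    double : ∀ M N → M * (N + (N + 0)) ≡ M * N + M * N
    double = solve-∀
    nz : NonZero (M * 2 ^ j + M * 2 ^ j)
    nz = subst NonZero (double M (2 ^ j)) (ℕ.m*n≢0 M (2 ^ suc j) {{nzM}} {{ℕ.m^n≢0 2 (suc j)}})
    lt : length ts ≤ 2 ^ j
    lt = subst (_≤ 2 ^ j) (sym (List.length-take (2 ^ j) xs)) (ℕ.m⊓n≤m (2 ^ j) (length xs))
    ld : length ds ≤ 2 ^ j
    ld = subst (_≤ 2 ^ j) (sym (List.length-drop (2 ^ j) xs))
      (ℕ.m≤n+o⇒m∸n≤o (length xs) (2 ^ j)
        (subst (length xs ≤_) (cong (2 ^ j +_) (ℕ.+-identityʳ (2 ^ j))) len))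
    halves : ∀ e → c e * (2 ^ j ∸ count (hits? e) ts) + c e * (2 ^ j ∸ count (hits? e) ds)
                 ≤ c e * (2 ^ suc j ∸ count (hits? e) xs)
    halves e = begin
      c e * (2 ^ j ∸ a) + c e * (2 ^ j ∸ b)
        ≡⟨ ℕ.*-distribˡ-+ (c e) (2 ^ j ∸ a) (2 ^ j ∸ b) ⟨
      c e * ((2 ^ j ∸ a) + (2 ^ j ∸ b))
        ≤⟨ ℕ.*-monoʳ-≤ (c e) (∸-+-≤ (ℕ.≤-trans (List.length-filter (hits? e) ts) lt)
                                    (ℕ.≤-trans (List.length-filter (hits? e) ds) ld)) ⟩
      c e * (2 ^ j + 2 ^ j ∸ (a + b))
        ≡⟨ cong₂ (λ N w → c e * (2 ^ j + N ∸ w)) (ℕ.+-identityʳ (2 ^ j))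
             (trans (cong (count (hits? e)) (sym (List.take++drop≡id (2 ^ j) xs))) (count-++ (hits? e) ts ds)) ⟨
      c e * (2 ^ suc j ∸ count (hits? e) xs) ∎
      where
      open ℕ.≤-Reasoning
      a = count (hits? e) ts
      b = count (hits? e) ds
    bound′ : (Σ[ pairs n ] λ e → c e * (2 ^ j ∸ count (hits? e) ts))
           + (Σ[ pairs n ] λ e → c e * (2 ^ j ∸ count (hits? e) ds))
           ≤ (Σ[ pairs n ] λ e → c e * (2 ^ suc j ∸ count (hits? e) xs))
    bound′ = subst (_≤ (Σ[ pairs n ] λ e → c e * (2 ^ suc j ∸ count (hits? e) xs)))
      (sym (Σ-+ (pairs n) _ _)) (Σ-mono (pairs n) halves)

  module _ (m L : ℕ) where
    open Discovery n m L

    N : ℕ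
    N = 2 ^ m

    instance
      N≢0 : NonZero N
      N≢0 = ℕ.m^n≢0 2 m

    -- Independent draws from the same list each contribute a factor `(N ∸ count (hits? e) xs) / N`.
    -- The coefficient `c` can be fixed beforehand because the next pool depends on the chosen pair
    -- and not on the draws.
    risk-samples : ∀ i xs {x k M} (c : Fin n × Fin n → ℕ) .{{_ : NonZero M}} → length xs ≤ N → ∀ qs →
      (∀ qs′ → length qs′ ≡ i + length qs →
        Risk G P? (k (map row qs′)) qs′ (Σ[ pairs n ] λ e → survive e qs′ * c e) M) →
      Risk G P? (samples i xs x (map row qs) k) qs
        (Σ[ pairs n ] λ e → survive e qs * (c e * (N ∸ count (hits? e) xs) ^ i)) (M * N ^ i)
    risk-samples zero xs {M = M} c len qs r = risk-mono G P?
      (Σ-mono (pairs n) λ e → ℕ.≤-reflexive (cong (survive e qs *_) (sym (ℕ.*-identityʳ (c e)))))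
      (subst (Risk G P? _ _ _) (sym (ℕ.*-identityʳ M)) (r qs refl))
    risk-samples (suc i) xs {x} {k} {M} c {{nzM}} len qs r =
      subst (Risk G P? _ qs _) (trans (ℕ.*-assoc M (N ^ i) N) (cong (M *_) (ℕ.*-comm (N ^ i) N)))
        (risk-mono G P? (Σ-mono (pairs n) λ e → ℕ.≤-reflexive
            (outer (survive e qs) (c e) (N ∸ count (hits? e) xs) ((N ∸ count (hits? e) xs) ^ i)))
          (risk-sample m xs (λ e → survive e qs * (c e * (N ∸ count (hits? e) xs) ^ i))
            {{ℕ.m*n≢0 M (N ^ i) {{nzM}} {{ℕ.m^n≢0 N i}}}} len after))
      where
      outer : ∀ s c d p → s * (c * p) * d ≡ s * (c * (d * p))
      outer = solve-∀
      inner : ∀ a s q → a * s * q ≡ s * q * a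
      inner = solve-∀
      after : ∀ v → Risk G P? (query v λ a → samples i xs x (dist a v ∷ map row qs) k) qs
        (Σ[ pairs n ] λ e → survive e qs * (c e * (N ∸ count (hits? e) xs) ^ i) * miss e v) (M * N ^ i)
      after v = risk-query G P? (risk-mono G P?
        (Σ-mono (pairs n) λ e → ℕ.≤-reflexive (inner (miss e v) (survive e qs) _))
        (risk-samples i xs c len (v ∷ qs) λ qs′ eq → r qs′ (trans eq (ℕ.+-suc i (length qs)))))

    -- The sum of the supermartingales of all ordered pairs, multiplied by `scale`. Summing builds
    -- the union bound into the induction.
    potential : List (Fin n) → List (Fin n) → ℕ
    potential qs pool = Σ[ pairs n ] λ e → survive e qs * (N + count (hits? e) pool) ^ L

    scale : ℕ
    scale = (N + N) ^ L

    instance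
      scale≢0 : NonZero scale
      scale≢0 = ℕ.m^n≢0 (N + N) L {{≢-nonZero λ eq → ≢-nonZero⁻¹ N (ℕ.m+n≡0⇒m≡0 N eq)}}

    -- Invariant: `r v` bounds the doublings left to `v`. Their sum over `cover` drops in every
    -- round, so it limits the rounds, stays below the fuel, and at `2 + L` queries per round keeps
    -- the total within `B`.
    risk-run : (cover : List (Fin n)) → (∀ x y → x ≢ y → ∃ λ v → v ∈ cover × Certifies G v x y) →
      (B : ℕ) → (∀ qs → CertifiesAll G (_∈ qs) → length qs ≤ B → P qs) →
      ∀ f qs pool (r : Fin n → ℕ) →
      (∀ v → N ≤ count (v ≟_) pool * 2 ^ r v) →
      (Σ[ cover ] r) < f →
      length qs + (Σ[ cover ] r) * (2 + L) ≤ B →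
      Risk G P? (run f (map row qs) pool) qs (potential qs pool) scale
    risk-run cover covers B good (suc f) qs pool r weights r<f len with unresolved? (map row qs)
    ... | no resolved = risk-certain G P? (good qs certified (ℕ.m+n≤o⇒m≤o (length qs) len))
      where
      certified : CertifiesAll G (_∈ qs)
      certified x y x≢y =
        let v , v∈qs , neq = find (Any.map⁻ (All.¬All⇒Any¬ (λ ρ → ρ x ℕ.≟ ρ y) _
              (λ eqs → resolved (x , y , x≢y , eqs))))
        in v , v∈qs , λ eq → neq (trans (dist≡d v x) (trans eq (sym (dist≡d v y))))
    ... | yes (x , y , x≢y , unres) = risk-query G P? (risk-query G P?
      (risk-if G P? (length xs ℕ.<? N) light (risk-trivial G P? ∘ heavy ∘ ℕ.≮⇒≥)))
      where
      e₀ = x , y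
      S? = differ? (row x) (row y)
      xs = filter S? pool

      row-sym : ∀ u v → row u v ≡ row v u
      row-sym u v = trans (dist≡d u v) (trans (d-sym u v) (sym (dist≡d v u)))

      -- The stuck pair is uncertified and its set weighs at least `N`, so its term alone reaches
      -- `(N + N) ^ L`.
      heavy : N ≤ length xs → scale ≤ potential qs pool
      heavy N≤xs = begin
        (N + N) ^ L
          ≤⟨ ℕ.^-monoˡ-≤ L (ℕ.+-monoʳ-≤ N (ℕ.≤-trans N≤xs (count-mono S? (hits? e₀)
               (λ v neq eq → neq (trans (row-sym x v) (trans eq (row-sym v y)))) pool))) ⟩
        (N + count (hits? e₀) pool) ^ L
          ≡⟨ ℕ.*-identityˡ _ ⟨
        1 * (N + count (hits? e₀) pool) ^ L
          ≡⟨ cong (_* (N + count (hits? e₀) pool) ^ L) (survive-unresolved x y qs unres) ⟨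
        survive e₀ qs * (N + count (hits? e₀) pool) ^ L
          ≤⟨ term≤Σ (λ e → survive e qs * (N + count (hits? e) pool) ^ L)
               (∈-cartesianProduct⁺ (∈-allFin x) (∈-allFin y)) ⟩
        potential qs pool ∎
        where open ℕ.≤-Reasoning

      -- In expectation the draws shrink the term of each pair at least as much as the new weights
      -- enlarge it.
      light : length xs < N →
              Risk G P? (samples L xs x (map row (y ∷ x ∷ qs)) (λ rows → run f rows (xs ++ pool)))
                (y ∷ x ∷ qs) (potential qs pool) scale
      light xs<N = risk-weaken G P? {{ℕ.m*n≢0 scale (N ^ L) {{scale≢0}} {{ℕ.m^n≢0 N L}}}} decrease
        (risk-samples L xs (λ e → (N + count (hits? e) (xs ++ pool)) ^ L) (ℕ.<⇒≤ xs<N) (y ∷ x ∷ qs)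
          λ qs′ len′ → risk-run cover covers B good f qs′ (xs ++ pool) r′ weights′
            (ℕ.<-≤-trans r′<r (s≤s⁻¹ r<f)) (cost qs′ len′))
        where
        open Doubling S? pool r weights xs<N using (r′; weights′; r′≤r; r′<r-at)

        -- Some vertex of `cover` certifies the pair, so it lies in the doubled set and loses one of
        -- its remaining doublings.
        r′<r : (Σ[ cover ] r′) < (Σ[ cover ] r)
        r′<r =
          let v , v∈cover , cert = covers x y x≢y
          in Σ-mono-< v∈cover r′≤r (r′<r-at v λ eq → cert
               (trans (sym (dist≡d v x)) (trans (row-sym v x) (trans eq (trans (row-sym y v) (dist≡d v y))))))

        -- The two queries at `x` and `y` and the `L` draws are paid for by one unit of the sum of
        -- `r`.
        cost : ∀ qs′ → length qs′ ≡ L + (2 + length qs) → length qs′ + (Σ[ cover ] r′) * (2 + L) ≤ B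
        cost qs′ eq = begin
          length qs′ + R′ * (2 + L)                 ≡⟨ cong (_+ R′ * (2 + L)) eq ⟩
          L + (2 + length qs) + R′ * (2 + L)        ≡⟨ regroup L (length qs) R′ ⟩
          length qs + suc R′ * (2 + L)              ≤⟨ ℕ.+-monoʳ-≤ (length qs) (ℕ.*-monoˡ-≤ (2 + L) r′<r) ⟩
          length qs + (Σ[ cover ] r) * (2 + L)      ≤⟨ len ⟩
          B                                         ∎
          where
          open ℕ.≤-Reasoning
          R′ = Σ[ cover ] r′
          regroup : ∀ L q R → L + (2 + q) + R * (2 + L) ≡ q + suc R * (2 + L)
          regroup = solve-∀

        pointwise : ∀ e →
          survive e (y ∷ x ∷ qs) * ((N + count (hits? e) (xs ++ pool)) ^ L * (N ∸ count (hits? e) xs) ^ L)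
          ≤ survive e qs * (N + count (hits? e) pool) ^ L * N ^ L
        pointwise e = begin
          survive e (y ∷ x ∷ qs) * ((N + count (hits? e) (xs ++ pool)) ^ L * (N ∸ δ) ^ L)
            ≡⟨ cong (λ w → survive e (y ∷ x ∷ qs) * ((N + w) ^ L * (N ∸ δ) ^ L)) (count-++ (hits? e) xs pool) ⟩
          survive e (y ∷ x ∷ qs) * ((N + (δ + W)) ^ L * (N ∸ δ) ^ L)
            -- Querying `x` and `y` can only lower `survive`; the `L` draws apply `potential-step`
            -- to the power `L`.
            ≤⟨ ℕ.*-mono-≤ (ℕ.≤-trans (survive-∷ e y (x ∷ qs)) (survive-∷ e x qs)) (begin
                 (N + (δ + W)) ^ L * (N ∸ δ) ^ L   ≡⟨ ^-distribʳ-* L (N + (δ + W)) (N ∸ δ) ⟨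
                 ((N + (δ + W)) * (N ∸ δ)) ^ L     ≤⟨ ℕ.^-monoˡ-≤ L (potential-step N W δ δ≤N) ⟩
                 ((N + W) * N) ^ L                 ≡⟨ ^-distribʳ-* L (N + W) N ⟩
                 (N + W) ^ L * N ^ L               ∎) ⟩
          survive e qs * ((N + W) ^ L * N ^ L)
            ≡⟨ ℕ.*-assoc (survive e qs) ((N + W) ^ L) (N ^ L) ⟨
          survive e qs * (N + W) ^ L * N ^ L ∎
          where
          open ℕ.≤-Reasoning
          δ = count (hits? e) xs
          W = count (hits? e) pool
          δ≤N = ℕ.≤-trans (List.length-filter (hits? e) xs) (ℕ.<⇒≤ xs<N)

        decrease : (Σ[ pairs n ] λ e → survive e (y ∷ x ∷ qs) *
                     ((N + count (hits? e) (xs ++ pool)) ^ L * (N ∸ count (hits? e) xs) ^ L)) * scale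
                   ≤ potential qs pool * (scale * N ^ L)
        decrease = begin
          _                                     ≤⟨ ℕ.*-monoˡ-≤ scale (Σ-mono (pairs n) pointwise) ⟩
          _                                     ≡⟨ cong (_* scale) (Σ-*ʳ (pairs n) _ (N ^ L)) ⟩
          potential qs pool * N ^ L * scale     ≡⟨ ℕ.*-assoc (potential qs pool) (N ^ L) scale ⟩
          potential qs pool * (N ^ L * scale)   ≡⟨ cong (potential qs pool *_) (ℕ.*-comm (N ^ L) scale) ⟩
          potential qs pool * (scale * N ^ L)   ∎
          where open ℕ.≤-Reasoning

-- Choice of parameters and the final bounds.

length-cartesianProduct : {B : Set} (xs : List A) (ys : List B) →
                          length (cartesianProduct xs ys) ≡ length xs * length ys
length-cartesianProduct []       ys = refl
length-cartesianProduct (x ∷ xs) ys = trans (List.length-++ (map (x ,_) ys))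
  (cong₂ _+_ (List.length-map (x ,_) ys) (length-cartesianProduct xs ys))

n<2^1+⌊log₂n⌋ : ∀ n → n < 2 ^ suc ⌊log₂ n ⌋
n<2^1+⌊log₂n⌋ n = ℕ.≰⇒> λ 2^1+l≤n → ℕ.1+n≰n
  (subst (_≤ ⌊log₂ n ⌋) (⌊log₂[2^n]⌋≡n (suc ⌊log₂ n ⌋)) (⌊log₂⌋-mono-≤ 2^1+l≤n))

-- The exponent of `N`: large enough for `N ≥ 2n`, and equal to the number of doublings that take
-- weight 1 to `N`.
bits : ℕ → ℕ
bits n = 2 + ⌊log₂ n ⌋

-- Chosen so that `(3/4) ^ draws n` is at most `1/n³`: a factor `n²` for the union over pairs, and
-- one `n` for the failure probability.
draws : ℕ → ℕ
draws n = 9 * suc ⌊log₂ n ⌋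

-- At most bits n doublings for each vertex of an optimal certificate: the fuel n * bits n suffices.
algorithm : ∀ n → Algorithm n
algorithm n = Discovery.run n (bits n) (draws n) (suc (n * bits n)) [] (allFin n)

2n≤2^bits : ∀ n → n + n ≤ 2 ^ bits n
2n≤2^bits n = ℕ.+-mono-≤ n≤ (ℕ.≤-trans n≤ (ℕ.m≤m+n _ 0))
  where n≤ = ℕ.<⇒≤ (n<2^1+⌊log₂n⌋ n)

-- With N ≥ 2n the ratio (N + n) / 2N is at most 3/4, and (3/4)^9 ≤ 1/8.
initial-risk : ∀ n N → n + n ≤ N → n * n * (N + n) ^ draws n * n ≤ (N + N) ^ draws n
initial-risk n N 2n≤N = ℕ.*-cancelʳ-≤ _ _ (4 ^ L) {{ℕ.m^n≢0 4 L}} (begin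
  n * n * (N + n) ^ L * n * 4 ^ L            ≡⟨ regroup n ((N + n) ^ L) (4 ^ L) ⟩
  n * n * n * ((N + n) ^ L * 4 ^ L)          ≡⟨ cong (n * n * n *_) (^-distribʳ-* L (N + n) 4) ⟨
  n * n * n * ((N + n) * 4) ^ L              ≤⟨ ℕ.*-monoʳ-≤ (n * n * n) (ℕ.^-monoˡ-≤ L ratio) ⟩
  n * n * n * ((N + N) * 3) ^ L              ≡⟨ cong (n * n * n *_) (^-distribʳ-* L (N + N) 3) ⟩
  n * n * n * ((N + N) ^ L * 3 ^ L)          ≤⟨ ℕ.*-monoˡ-≤ ((N + N) ^ L * 3 ^ L) n³≤8^1+l ⟩
  8 ^ suc l * ((N + N) ^ L * 3 ^ L)          ≡⟨ rotate (8 ^ suc l) ((N + N) ^ L) (3 ^ L) ⟩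
  (N + N) ^ L * (8 ^ suc l * 3 ^ L)          ≤⟨ ℕ.*-monoʳ-≤ ((N + N) ^ L) powers ⟩
  (N + N) ^ L * 4 ^ L                        ∎)
  where
  open ℕ.≤-Reasoning
  l = ⌊log₂ n ⌋
  L = draws n
  regroup : ∀ n p q → n * n * p * n * q ≡ n * n * n * (p * q)
  regroup = solve-∀
  rotate : ∀ a b c → a * (b * c) ≡ b * (a * c)
  rotate = solve-∀
  ratio : (N + n) * 4 ≤ (N + N) * 3
  ratio = begin
    (N + n) * 4              ≡⟨ split N n ⟩
    N * 4 + (n + n) * 2      ≤⟨ ℕ.+-monoʳ-≤ (N * 4) (ℕ.*-monoˡ-≤ 2 2n≤N) ⟩
    N * 4 + N * 2            ≡⟨ merge N ⟩
    (N + N) * 3              ∎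
    where
    split : ∀ N n → (N + n) * 4 ≡ N * 4 + (n + n) * 2
    split = solve-∀
    merge : ∀ N → N * 4 + N * 2 ≡ (N + N) * 3
    merge = solve-∀
  n³≤8^1+l : n * n * n ≤ 8 ^ suc l
  n³≤8^1+l = begin
    n * n * n                                ≤⟨ ℕ.*-mono-≤ (ℕ.*-mono-≤ n≤ n≤) n≤ ⟩
    2 ^ suc l * 2 ^ suc l * 2 ^ suc l        ≡⟨ cong (_* 2 ^ suc l) (^-distribʳ-* (suc l) 2 2) ⟨
    4 ^ suc l * 2 ^ suc l                    ≡⟨ ^-distribʳ-* (suc l) 4 2 ⟨
    8 ^ suc l                                ∎
    where n≤ = ℕ.<⇒≤ (n<2^1+⌊log₂n⌋ n)
  powers : 8 ^ suc l * 3 ^ L ≤ 4 ^ L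
  powers = begin
    8 ^ suc l * 3 ^ L              ≡⟨ cong (8 ^ suc l *_) (ℕ.^-*-assoc 3 9 (suc l)) ⟨
    8 ^ suc l * (3 ^ 9) ^ suc l    ≡⟨ ^-distribʳ-* (suc l) 8 (3 ^ 9) ⟨
    (8 * 3 ^ 9) ^ suc l            ≤⟨ ℕ.^-monoˡ-≤ (suc l) (toWitness {a? = 8 * 3 ^ 9 ≤? 4 ^ 9} _) ⟩
    (4 ^ 9) ^ suc l                ≡⟨ ℕ.^-*-assoc 4 9 (suc l) ⟩
    4 ^ L                          ∎

-- Since `n ≥ 2`, the logarithm is at least 1 and absorbs the additive constants: the factors are at
-- most 3 and 20 logarithms, whence 60.
query-bound : ∀ n .{{_ : NonTrivial n}} k → k * bits n * (2 + draws n) ≤ 60 * ⌊log₂ n ⌋ ^ 2 * k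
query-bound n k with ⌊log₂ n ⌋ | n<2^1+⌊log₂n⌋ n
... | zero  | n<2 = contradiction (nonTrivial⇒n>1 n) (ℕ.<⇒≱ n<2)
... | suc l | _   = begin
  k * (2 + suc l) * (2 + 9 * suc (suc l))  ≤⟨ ℕ.*-mono-≤ (ℕ.*-monoʳ-≤ k bits≤) draws≤ ⟩
  k * (3 * suc l) * (20 * suc l)           ≡⟨ collect k (suc l) ⟩
  60 * suc l ^ 2 * k                       ∎
  where
  open ℕ.≤-Reasoning
  bits≤ : 2 + suc l ≤ 3 * suc l
  bits≤ = ℕ.≤-trans (ℕ.m≤m+n (2 + suc l) (2 * l)) (ℕ.≤-reflexive (fill l))
    where
    fill : ∀ l → 2 + suc l + 2 * l ≡ 3 * suc l
    fill = solve-∀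
  draws≤ : 2 + 9 * suc (suc l) ≤ 20 * suc l
  draws≤ = ℕ.≤-trans (ℕ.m≤m+n (2 + 9 * suc (suc l)) (11 * l)) (ℕ.≤-reflexive (fill l))
    where
    fill : ∀ l → 2 + 9 * suc (suc l) + 11 * l ≡ 20 * suc l
    fill = solve-∀
  collect : ∀ k l → k * (3 * l) * (20 * l) ≡ 60 * (l * (l * 1)) * k
  collect = solve-∀

theorem6p1 : ∃ λ (C : ℕ) → 0 < C × Σ ((n : ℕ) → Algorithm n) λ A →
    (n : ℕ) .{{_ : NonTrivial n}} (G : ConnectedGraph n) →
    WithHighProbability n G (A n) λ qs →
    certifiesAll? G (λ v → _∈?_ _≟_ v qs)
    ×-dec (length qs ≤? C * ⌊log₂ n ⌋ ^ 2 * OPT G)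
theorem6p1 = 60 , s≤s z≤n , algorithm , whp
  where
  module _ (n : ℕ) .{{nt : NonTrivial n}} (G : ConnectedGraph n) where
    P? : Decidable λ qs → CertifiesAll G (_∈ qs) × length qs ≤ 60 * ⌊log₂ n ⌋ ^ 2 * OPT G
    P? qs = certifiesAll? G (λ v → _∈?_ _≟_ v qs) ×-dec (length qs ≤? 60 * ⌊log₂ n ⌋ ^ 2 * OPT G)

    open Analysis G P?

    m L : ℕ
    m = bits n
    L = draws n

    optimal : CertifiableWith G (OPT G)
    optimal = proj₁ (proj₂ (least (certifiableWith? G) _ (proj₂ (certifiable G))))

    S = proj₁ optimal

    cover : List (Fin n)
    cover = elements S

    covers : ∀ x y → x ≢ y → ∃ λ v → v ∈ cover × Certifies G v x y
    covers x y x≢y = let v , v∈S , cert = proj₁ (proj₂ optimal) x y x≢y in v , ∈-elements S v∈S , cert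

    doublings : (Σ[ cover ] const m) ≡ OPT G * m
    doublings = trans (Σ-const cover m)
      (cong (_* m) (trans (length-elements S) (proj₂ (proj₂ optimal))))

    doublings≤ : (Σ[ cover ] const m) ≤ n * m
    doublings≤ = subst (_≤ n * m) (sym (Σ-const cover m))
      (ℕ.*-monoˡ-≤ m (subst (_≤ n) (sym (length-elements S)) (∣p∣≤n S)))

    cost : (Σ[ cover ] const m) * (2 + L) ≤ 60 * ⌊log₂ n ⌋ ^ 2 * OPT G
    cost = subst (λ d → d * (2 + L) ≤ 60 * ⌊log₂ n ⌋ ^ 2 * OPT G) (sym doublings) (query-bound n (OPT G))

    weights : ∀ v → N m L ≤ count (v ≟_) (allFin n) * 2 ^ m
    weights v = ℕ.m≤n*m (2 ^ m) (count (v ≟_) (allFin n))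
      {{>-nonZero (∈-length (∈-filter⁺ (v ≟_) (∈-allFin v) refl))}}

    initial : potential m L [] (allFin n) * n ≤ scale m L
    initial = begin
      potential m L [] (allFin n) * n
        -- Before any query `survive` is the empty product 1, and no set weighs more than `n`.
        ≤⟨ ℕ.*-monoˡ-≤ n (Σ-mono (pairs n) λ e → ℕ.≤-trans (ℕ.≤-reflexive (ℕ.*-identityˡ _))
             (ℕ.^-monoˡ-≤ L (ℕ.+-monoʳ-≤ (2 ^ m) (weight≤n e)))) ⟩
      (Σ[ pairs n ] const ((2 ^ m + n) ^ L)) * n
        ≡⟨ cong (_* n) (trans (Σ-const (pairs n) _) (cong (_* (2 ^ m + n) ^ L) length-pairs)) ⟩
      n * n * (2 ^ m + n) ^ L * n
        ≤⟨ initial-risk n (2 ^ m) (2n≤2^bits n) ⟩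
      scale m L ∎
      where
      open ℕ.≤-Reasoning
      length-allFin : length (allFin n) ≡ n
      length-allFin = List.length-tabulate {n = n} _
      length-pairs : length (pairs n) ≡ n * n
      length-pairs = trans (length-cartesianProduct (allFin n) (allFin n))
        (cong₂ _*_ length-allFin length-allFin)
      weight≤n : ∀ e → count (hits? e) (allFin n) ≤ n
      weight≤n e = subst (count (hits? e) (allFin n) ≤_) length-allFin (List.length-filter (hits? e) (allFin n))

    whp : WithHighProbability n G (algorithm n) P?
    whp = risk⇒whp G P? {{nt}} {{scale≢0 m L}} initial
      -- `B` is exactly the initial budget, so its condition holds by reflexivity. The fuel suffices
      -- because a certificate has at most `n` vertices.
      (risk-run m L cover covers ((Σ[ cover ] const m) * (2 + L))
        (λ qs certified len → certified , ℕ.≤-trans len cost)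
        (suc (n * m)) [] (allFin n) (const m) weights (s≤s doublings≤) ℕ.≤-refl)
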